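{- Let $p$ be an odd prime. (a) Let $q$ be a prime and $k$ a positive integer, and, when $q\neq p$, let $r = \mathrm{Ord}_p(q)$. Then $$\nu_p(\sigma(q^k)) = \begin{cases} \nu_p(k+1), & \text{if } q\equiv 1 \pmod p,\\ 0, & \text{if } p=q \text{ or } (q\not\equiv 1 \pmod p \text{ and } k\not\equiv -1 \pmod r),\\ \nu_p(k+1)+\nu_p(q^r-1), & \text{otherwise.}\end{cases}$$ (b) Consequently, for every positive integer $n$, $$\nu_p(\sigma(n)) = \sum_{\substack{q\mid n\\ q\equiv 1 \bmod p}} \nu_p(\nu_q(n)+1) + \sum_{\substack{q\mid n,\ q\neq p\\ q\not\equiv 1 \bmod p\\ \mathrm{Ord}_p(q)\,\mid\,(\nu_q(n)+1)}} \left(\nu_p(\nu_q(n)+1)+\nu_p\left(q^{\mathrm{Ord}_p(q)}-1\right)\right),$$ where $q$ runs over the primes dividing $n$ with the indicated properties.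
   Context: For a prime $p$ and a positive integer $m$, $\nu_p(m)$ denotes the exponent of the highest power of $p$ dividing $m$. $\sigma(n)$ denotes the sum of the positive divisors of $n$. For a prime $q\ne p$, $\mathrm{Ord}_p(q)$ is the order of $q$ modulo $p$, i.e. the minimal positive integer $r$ with $q^r\equiv 1 \pmod p$. -}

module Defs where

open import Data.Bool.Base using (if_then_else_)
open import Data.Empty using (⊥-elim)
open import Data.Fin.Base as Fin using (Fin; toℕ; fromℕ<)
open import Data.Fin.Properties using (pigeonhole; toℕ-fromℕ<; toℕ<n)
open import Data.Integer.Base as ℤ using (ℤ; +_)
import Data.Integer.Divisibility.Signed as ℤ
import Data.Integer.Properties as ℤ
open import Data.List.Base using (List; map; filter; upTo)
open import Data.Nat.Base
open import Data.Nat.Divisibility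
open import Data.Nat.DivMod using (_%_; m≡m%n+[m/n]*n; m%n<n; _/_)
open import Data.Nat.ListAction using (sum)
open import Data.Nat.Primality
open import Data.Nat.Properties
open import Data.Product.Base using (_×_; _,_; ∃)
open import Data.Sum.Base using (_⊎_; inj₁; inj₂)
open import Level using (0ℓ)
open import Relation.Binary.PropositionalEquality
open import Relation.Nullary.Decidable using (Dec; yes; no; does)
open import Relation.Nullary.Negation using (¬_; contradiction)
open import Relation.Unary using (Pred; Decidable)

infix 4 _≡_[mod_] _≡?_[mod_]

_≡_[mod_] : ℤ → ℤ → ℕ → Set
i ≡ j [mod m ] = (+ m) ℤ.∣ (i ℤ.- j)

_≡?_[mod_] : ∀ i j m → Dec (i ≡ j [mod m ])
i ≡? j [mod m ] = (+ m) ℤ.∣? (i ℤ.- j)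

divisors : ℕ → List ℕ
divisors n = filter (_∣? n) (map suc (upTo n))

primeDivisors : ℕ → List ℕ
primeDivisors n = filter prime? (divisors n)

σ : ℕ → ℕ
σ n = sum (divisors n)

-- The greatest i with 1 ≤ i ≤ n satisfying P, or 0 if there is none.
greatest : {P : Pred ℕ 0ℓ} → Decidable P → ℕ → ℕ
greatest P? zero    = zero
greatest P? (suc n) = if does (P? (suc n)) then suc n else greatest P? n

-- The least i with 1 ≤ i ≤ n satisfying P, or 0 if there is none.
least : {P : Pred ℕ 0ℓ} → Decidable P → ℕ → ℕ
least P? zero    = zero
least P? (suc n) with least P? n
... | zero  = if does (P? (suc n)) then suc n else zero
... | suc i = suc i

-- The search bound m loses nothing for p ≥ 2 and m ≥ 1, as e < p ^ e;
-- see ν-spec.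
ν : ℕ → ℕ → ℕ
ν p m = greatest (λ e → p ^ e ∣? m) m

-- The search bound p loses nothing for p prime and p ∤ q; see ord-spec.
-- If p ∣ q then no order exists and the value is irrelevant.
ord : ℕ → ℕ → ℕ
ord p q = least (λ r → + (q ^ r) ≡? + 1 [mod p ]) p

private
  greatest-sat : ∀ {P} (P? : Decidable P) → P 0 → ∀ n → P (greatest P? n)
  greatest-sat P? P0 zero = P0
  greatest-sat P? P0 (suc n) with P? (suc n)
  ... | yes Pn = Pn
  ... | no  _  = greatest-sat P? P0 n

  greatest-max : ∀ {P} (P? : Decidable P) n {i} → i ≤ n → P i →
                 i ≤ greatest P? n
  greatest-max P? zero i≤0 Pi = i≤0
  greatest-max {P} P? (suc n) i≤1+n Pi with P? (suc n)
  ... | yes _  = i≤1+n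
  ... | no ¬P with m≤n⇒m<n∨m≡n i≤1+n
  ...   | inj₁ (s≤s i≤n) = greatest-max P? n i≤n Pi
  ...   | inj₂ refl      = contradiction Pi ¬P

  LeastSpec : Pred ℕ 0ℓ → ℕ → ℕ → Set
  LeastSpec P n zero      = ∀ {i} → 0 < i → i ≤ n → ¬ P i
  LeastSpec P n r@(suc _) = P r × r ≤ n × (∀ {i} → 0 < i → P i → r ≤ i)

  least-spec : ∀ {P} (P? : Decidable P) n → LeastSpec P n (least P? n)
  least-spec P? zero 0<i i≤0 _ = <⇒≱ 0<i i≤0
  least-spec {P} P? (suc n) with least P? n | least-spec P? n
  ... | suc i | Pi , i≤n , min = Pi , m≤n⇒m≤1+n i≤n , min
  ... | zero  | none with P? (suc n)
  ...   | yes Pn = Pn , ≤-refl , min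
    where
    min : ∀ {i} → 0 < i → P i → suc n ≤ i
    min 0<i Pi = ≰⇒> (λ i≤n → none 0<i i≤n Pi)
  ...   | no ¬Pn = none′
    where
    none′ : ∀ {i} → 0 < i → i ≤ suc n → ¬ P i
    none′ 0<i i≤1+n Pi with m≤n⇒m<n∨m≡n i≤1+n
    ... | inj₁ (s≤s i≤n) = none 0<i i≤n Pi
    ... | inj₂ refl      = ¬Pn Pi

  e<p^e : ∀ p .{{_ : NonTrivial p}} e → e < p ^ e
  e<p^e p zero = z<s
  e<p^e p@(2+ _) (suc e) = begin-strict
    suc e        ≤⟨ e<p^e p e ⟩
    p ^ e        <⟨ m<n*m (p ^ e) p {{m^n≢0 p e}} (s≤s (s≤s z≤n)) ⟩
    p * p ^ e    ∎
    where
    open ≤-Reasoning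
    m<n*m : ∀ m n .{{_ : NonZero m}} → 1 < n → m < n * m
    m<n*m m n 1<n = subst (m <_) (*-comm m n) (m<m*n m n 1<n)

  %≡⇒∣∸ : ∀ p .{{_ : NonZero p}} a b → a % p ≡ b % p → p ∣ b ∸ a
  %≡⇒∣∸ p a b eq = divides (b / p ∸ a / p) (begin
    b ∸ a                                          ≡⟨ cong₂ _∸_ (m≡m%n+[m/n]*n b p) (m≡m%n+[m/n]*n a p) ⟩
    (b % p + b / p * p) ∸ (a % p + a / p * p)      ≡⟨ cong (λ t → (b % p + b / p * p) ∸ (t + a / p * p)) eq ⟩
    (b % p + b / p * p) ∸ (b % p + a / p * p)      ≡⟨ [m+n]∸[m+o]≡n∸o (b % p) _ _ ⟩
    b / p * p ∸ a / p * p                          ≡⟨ *-distribʳ-∸ p (b / p) (a / p) ⟨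
    (b / p ∸ a / p) * p                            ∎)
    where open ≡-Reasoning

  prime∣^⇒∣ : ∀ {p} q → Prime p → ∀ n → p ∣ q ^ n → p ∣ q
  prime∣^⇒∣ {p} q pp zero p∣1 =
    ⊥-elim (¬prime[1] (subst Prime (∣1⇒≡1 p∣1) pp))
  prime∣^⇒∣ q pp (suc n) p∣ with euclidsLemma q (q ^ n) pp p∣
  ... | inj₁ p∣q = p∣q
  ... | inj₂ p∣  = prime∣^⇒∣ q pp n p∣

  ∣∸1⇒≡1 : ∀ {p m} → 0 < m → p ∣ m ∸ 1 → + m ≡ + 1 [mod p ]
  ∣∸1⇒≡1 {p} {suc m} _ p∣m =
    ℤ.∣ᵤ⇒∣ (subst (λ t → p ∣ ℤ.∣ t ∣) (sym (ℤ.m-n≡m⊖n (suc m) 1)) p∣m)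

  order-exists : ∀ {p q} → Prime p → ¬ p ∣ q →
                 ∃ λ r → 0 < r × r ≤ p × + (q ^ r) ≡ + 1 [mod p ]
  order-exists {p} {q} pp p∤q = go (pigeonhole (n<1+n p) f)
    where
    instance _ = prime⇒nonZero pp
    f : Fin (suc p) → Fin p
    f i = fromℕ< (m%n<n (q ^ toℕ i) p)
    0<q : 0 < q
    0<q = n≢0⇒n>0 (λ { refl → p∤q (p ∣0) })
    instance q≢0 = >-nonZero 0<q
    go : _ → ∃ λ r → 0 < r × r ≤ p × + (q ^ r) ≡ + 1 [mod p ]
    go (i , j , i<j , eq) = d , m<n⇒0<n∸m i<j , d≤p , ∣∸1⇒≡1 (>-nonZero⁻¹ _ {{m^n≢0 q d}}) p∣
      where
      a b d : ℕ
      a = toℕ i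
      b = toℕ j
      d = b ∸ a
      d≤p : d ≤ p
      d≤p = ≤-trans (m∸n≤m b a) (≤-pred (toℕ<n j))
      eq% : q ^ a % p ≡ q ^ b % p
      eq% = trans (sym (toℕ-fromℕ< _)) (trans (cong toℕ eq) (toℕ-fromℕ< _))
      factor : q ^ b ∸ q ^ a ≡ q ^ a * (q ^ d ∸ 1)
      factor = begin
        q ^ b ∸ q ^ a                 ≡⟨ cong (λ t → q ^ t ∸ q ^ a) (m+[n∸m]≡n (<⇒≤ i<j)) ⟨
        q ^ (a + d) ∸ q ^ a           ≡⟨ cong (_∸ q ^ a) (^-distribˡ-+-* q a d) ⟩
        q ^ a * q ^ d ∸ q ^ a         ≡⟨ cong (q ^ a * q ^ d ∸_) (*-identityʳ (q ^ a)) ⟨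
        q ^ a * q ^ d ∸ q ^ a * 1     ≡⟨ *-distribˡ-∸ (q ^ a) (q ^ d) 1 ⟨
        q ^ a * (q ^ d ∸ 1)           ∎
        where open ≡-Reasoning
      p∣ : p ∣ q ^ d ∸ 1
      p∣ with euclidsLemma (q ^ a) (q ^ d ∸ 1) pp (subst (p ∣_) factor (%≡⇒∣∸ p (q ^ a) (q ^ b) eq%))
      ... | inj₁ p∣q^a = contradiction (prime∣^⇒∣ q pp a p∣q^a) p∤q
      ... | inj₂ h     = h

ν-spec : ∀ p m .{{_ : NonTrivial p}} .{{_ : NonZero m}} →
         p ^ ν p m ∣ m × (∀ {e} → p ^ e ∣ m → e ≤ ν p m)
ν-spec p m =
  greatest-sat (λ e → p ^ e ∣? m) (1∣ m) m ,
  λ {e} p^e∣m → greatest-max (λ e → p ^ e ∣? m) m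
    (<⇒≤ (<-≤-trans (e<p^e p e) (∣⇒≤ p^e∣m))) p^e∣m

ord-spec : ∀ {p q} → Prime p → ¬ p ∣ q →
           0 < ord p q ×
           + (q ^ ord p q) ≡ + 1 [mod p ] ×
           (∀ {s} → 0 < s → + (q ^ s) ≡ + 1 [mod p ] → ord p q ≤ s)
ord-spec {p} {q} pp p∤q
  with ord p q | least-spec (λ r → + (q ^ r) ≡? + 1 [mod p ]) p
... | suc r | eq , _ , min = z<s , eq , min
... | zero  | none with r , 0<r , r≤p , eq ← order-exists pp p∤q
  = contradiction eq (none 0<r r≤p)

{-# OPTIONS --safe #-}

-- Write [n]ₓ = 1 + x + … + x ^ (n - 1), so σ (q ^ k) = [k + 1]_q.  If x = 1 + y with
-- p ∣ y, then [n]ₓ = n + y (n (n - 1) / 2 + y s) for some s.  Hence [n]ₓ ≡ n mod p and, p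
-- being odd, [p]ₓ ≡ p mod p²; together with [mn]ₓ = [m]ₓ [n]_(x ^ m) this gives
-- ν_p [n]ₓ = ν_p n, which is the case q ≡ 1.  Otherwise p ∤ q - 1, so
-- q ^ n - 1 = (q - 1) [n]_q shows that p ∣ [n]_q only if r ∣ n, and then
-- [rs]_q = [r]_q [s]_(q ^ r), whose second factor has valuation ν_p s = ν_p (rs) as r < p.
-- Part (b) follows since σ (q ^ k * m) = σ (q ^ k) σ m when q ∤ m, which comes from
-- splitting the divisors of q ^ (k + 1) * m into those of m and q times those of q ^ k * m.

module Submission where

open import Defs
open import Data.Fin.Base using (Fin; zero; suc; toℕ)
open import Data.Fin.Properties using (pigeonhole; toℕ<n; toℕ-fromℕ<)
open import Data.Integer.Base using (+_; -1ℤ)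
import Data.Integer.Divisibility.Signed as ℤ
open import Data.List.Base using (List; []; _∷_; _++_; map; filter; upTo)
open import Data.List.Membership.Propositional using (_∈_)
open import Data.List.Membership.Propositional.Properties
open import Data.List.Properties using (filter-accept; filter-reject; map-cong-local)
open import Data.List.Relation.Binary.Permutation.Propositional using (_↭_)
open import Data.List.Relation.Binary.Permutation.Propositional.Properties using (map⁺)
open import Data.List.Membership.Propositional.Properties.WithK using (unique∧set⇒bag)
open import Data.List.Relation.Binary.BagAndSetEquality using (∼bag⇒↭)
open import Data.List.Relation.Unary.All as All using (All; []; _∷_)
open import Data.List.Relation.Unary.Any using (here; there)
open import Data.List.Relation.Unary.Unique.Propositional using (Unique; _∷_)
import Data.List.Relation.Unary.Unique.Propositional.Properties as Unique
open import Data.Nat.Base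
open import Data.Nat.Coprimality using (Coprime; coprime-divisor)
open import Data.Nat.Divisibility
open import Data.Nat.DivMod
open import Data.Nat.Induction using (<-rec)
open import Data.Nat.ListAction using (sum)
open import Data.Nat.ListAction.Properties using (sum-++; sum-↭)
open import Data.Nat.Primality
open import Data.Nat.Primality.Factorisation using (factorise)
open import Data.Nat.Properties
open import Data.Nat.Tactic.RingSolver using (solve-∀)
open import Data.Product.Base using (_×_; _,_; ∃; proj₁; proj₂)
open import Data.Sum.Base using (_⊎_; inj₁; inj₂)
open import Function.Base using (_∘_)
open import Function.Bundles using (mk⇔)
open import Level using (0ℓ)
open import Relation.Binary.PropositionalEquality
open import Relation.Nullary.Decidable using (¬?; _×-dec_; yes; no; decidable-stable)
open import Relation.Nullary.Negation using (¬_; contradiction)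
open import Relation.Unary using (Pred; Decidable)

-- Divisibility by primes

∤⇒nonZero : ∀ {p m} → ¬ p ∣ m → NonZero m
∤⇒nonZero {p} p∤m = ≢-nonZero λ { refl → p∤m (p ∣0) }

prime∤1 : ∀ {p} → Prime p → ¬ p ∣ 1
prime∤1 pp p∣1 = ¬prime[1] (subst Prime (∣1⇒≡1 p∣1) pp)

prime∣prime⇒≡ : ∀ {p q} → Prime p → Prime q → p ∣ q → p ≡ q
prime∣prime⇒≡ pp pq p∣q with prime⇒irreducible pq p∣q
... | inj₁ refl = contradiction pp ¬prime[1]
... | inj₂ p≡q  = p≡q

∤-* : ∀ {p m n} → Prime p → ¬ p ∣ m → ¬ p ∣ n → ¬ p ∣ m * n
∤-* {m = m} {n} pp p∤m p∤n p∣mn with euclidsLemma m n pp p∣mn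
... | inj₁ p∣m = p∤m p∣m
... | inj₂ p∣n = p∤n p∣n

∤-^ : ∀ {p m} → Prime p → ¬ p ∣ m → ∀ n → ¬ p ∣ m ^ n
∤-^ pp p∤m zero    = prime∤1 pp
∤-^ pp p∤m (suc n) = ∤-* pp p∤m (∤-^ pp p∤m n)

-- As `q` is prime and does not divide `d`, the two are coprime, and Gauss's lemma cancels the
-- factors `q` one at a time.
∣prime^*⇒∣ : ∀ {q d m} → Prime q → ¬ q ∣ d → ∀ k → d ∣ q ^ k * m → d ∣ m
∣prime^*⇒∣ {q} {d} {m} pq q∤d zero    d∣ = subst (d ∣_) (*-identityˡ m) d∣
∣prime^*⇒∣ {q} {d} {m} pq q∤d (suc k) d∣ =
  ∣prime^*⇒∣ pq q∤d k (coprime-divisor coprime (subst (d ∣_) (*-assoc q (q ^ k) m) d∣))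
  where
  coprime : Coprime d q
  coprime (c∣d , c∣q) with prime⇒irreducible pq c∣q
  ... | inj₁ c≡1  = c≡1
  ... | inj₂ refl = contradiction c∣d q∤d

prime^*≢0 : ∀ {q m} → Prime q → ∀ k → NonZero m → NonZero (q ^ k * m)
prime^*≢0 {q} {m} pq k m≢0 = m*n≢0 (q ^ k) m {{m^n≢0 q k {{prime⇒nonZero pq}}}} {{m≢0}}

-- Valuations at a prime

module _ {p : ℕ} (pp : Prime p) where

  private instance
    p≢0 = prime⇒nonZero pp
    p>1 = prime⇒nonTrivial pp

  -- A larger valuation would make `p ^ suc e` divide `p ^ e * u`, and cancelling `p ^ e` leaves
  -- `p ∣ u`. Together with `ν-factor` this replaces the bounded search behind `ν` by the
  -- decomposition into a power of `p` and a cofactor prime to `p`.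
  ν[p^e*u]≡e : ∀ e {u} → ¬ p ∣ u → ν p (p ^ e * u) ≡ e
  ν[p^e*u]≡e e {u} p∤u = ≤-antisym (≮⇒≥ e≮ν) (proj₂ spec (m∣m*n u))
    where
    instance
      _ = prime^*≢0 pp e (∤⇒nonZero p∤u)
      _ = m^n≢0 p e
    spec = ν-spec p (p ^ e * u)
    e≮ν : ¬ e < ν p (p ^ e * u)
    e≮ν e<ν = p∤u (*-cancelˡ-∣ (p ^ e) (∣-trans (∣-reflexive (*-comm (p ^ e) p))
      (∣-trans p^1+e∣p^ν (proj₁ spec))))
      where
      p^1+e∣p^ν : p ^ suc e ∣ p ^ ν p (p ^ e * u)
      p^1+e∣p^ν = subst (λ k → p ^ suc e ∣ p ^ k) (m+[n∸m]≡n e<ν)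
        (subst (p ^ suc e ∣_) (sym (^-distribˡ-+-* p (suc e) _)) (m∣m*n _))

  ν-factor : ∀ m .{{_ : NonZero m}} → ∃ λ u → m ≡ p ^ ν p m * u × ¬ p ∣ u
  ν-factor m with divides u m≡u*p^ν ← proj₁ (ν-spec p m) =
    -- If `p` divided the cofactor, `p ^ suc (ν p m)` would divide `m`, against the maximality of
    -- `ν p m`.
    u , m≡p^ν*u , λ { (divides v u≡v*p) → <-irrefl refl (proj₂ (ν-spec p m) (divides v (begin
      m                      ≡⟨ m≡u*p^ν ⟩
      u * p ^ ν p m          ≡⟨ cong (_* p ^ ν p m) u≡v*p ⟩
      v * p * p ^ ν p m      ≡⟨ *-assoc v p _ ⟩
      v * p ^ suc (ν p m)    ∎))) }
    where
    open ≡-Reasoning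
    m≡p^ν*u = trans m≡u*p^ν (*-comm u _)

  ν-∤ : ∀ {m} → ¬ p ∣ m → ν p m ≡ 0
  ν-∤ {m} p∤m = trans (cong (ν p) (sym (*-identityˡ m))) (ν[p^e*u]≡e 0 p∤m)

  ν-* : ∀ m n .{{_ : NonZero m}} .{{_ : NonZero n}} → ν p (m * n) ≡ ν p m + ν p n
  ν-* m n with u , m≡ , p∤u ← ν-factor m | v , n≡ , p∤v ← ν-factor n = begin
    ν p (m * n)                                ≡⟨ cong (ν p) (cong₂ _*_ m≡ n≡) ⟩
    ν p (p ^ ν p m * u * (p ^ ν p n * v))      ≡⟨ cong (ν p) (rearrange (p ^ ν p m) (p ^ ν p n) u v) ⟩
    ν p (p ^ ν p m * p ^ ν p n * (u * v))
      ≡⟨ cong (λ t → ν p (t * (u * v))) (^-distribˡ-+-* p (ν p m) (ν p n)) ⟨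
    ν p (p ^ (ν p m + ν p n) * (u * v))        ≡⟨ ν[p^e*u]≡e (ν p m + ν p n) (∤-* pp p∤u p∤v) ⟩
    ν p m + ν p n                              ∎
    where
    open ≡-Reasoning
    rearrange : ∀ a b u v → a * u * (b * v) ≡ a * b * (u * v)
    rearrange = solve-∀

  ν-∤* : ∀ {m} n .{{_ : NonZero n}} → ¬ p ∣ m → ν p (m * n) ≡ ν p n
  ν-∤* {m} n p∤m = trans (ν-* m n {{∤⇒nonZero p∤m}}) (cong (_+ ν p n) (ν-∤ p∤m))

-- Geometric sums

-- The sum [n]ₓ in Horner form: no division by `x ∸ 1` occurs, so `x = 1` is covered, and the
-- recursion matches the one that `σ` obeys on powers of a prime.
geom : ℕ → ℕ → ℕ
geom x zero    = 0
geom x (suc n) = 1 + x * geom x n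

geom≢0 : ∀ x n .{{_ : NonZero n}} → NonZero (geom x n)
geom≢0 x (suc n) = _

geom-+ : ∀ x m n → geom x (m + n) ≡ geom x m + x ^ m * geom x n
geom-+ x zero    n = sym (*-identityˡ (geom x n))
geom-+ x (suc m) n = trans (cong (λ t → 1 + x * t) (geom-+ x m n)) (rearrange x (geom x m) (x ^ m) (geom x n))
  where
  rearrange : ∀ x a b c → 1 + x * (a + b * c) ≡ 1 + x * a + x * b * c
  rearrange = solve-∀

-- The `m * n` terms fall into `n` consecutive blocks of length `m`, each `x ^ m` times the
-- preceding one.
geom-* : ∀ x m n → geom x (m * n) ≡ geom x m * geom (x ^ m) n
geom-* x m zero    = trans (cong (geom x) (*-zeroʳ m)) (sym (*-zeroʳ (geom x m)))
geom-* x m (suc n) = begin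
  geom x (m * suc n)                                    ≡⟨ cong (geom x) (*-suc m n) ⟩
  geom x (m + m * n)                                    ≡⟨ geom-+ x m (m * n) ⟩
  geom x m + x ^ m * geom x (m * n)
    ≡⟨ cong (λ t → geom x m + x ^ m * t) (geom-* x m n) ⟩
  geom x m + x ^ m * (geom x m * geom (x ^ m) n)        ≡⟨ rearrange (geom x m) (x ^ m) _ ⟩
  geom x m * (1 + x ^ m * geom (x ^ m) n)               ∎
  where
  open ≡-Reasoning
  rearrange : ∀ a b c → a + b * (a * c) ≡ a * (1 + b * c)
  rearrange = solve-∀

[1+y]^n≡1+y*geom : ∀ y n → suc y ^ n ≡ 1 + y * geom (suc y) n
[1+y]^n≡1+y*geom y zero    = cong suc (sym (*-zeroʳ y))
[1+y]^n≡1+y*geom y (suc n) = trans (cong (suc y *_) ([1+y]^n≡1+y*geom y n)) (rearrange y (geom (suc y) n))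
  where
  rearrange : ∀ y g → (1 + y) * (1 + y * g) ≡ 1 + y * (1 + (1 + y) * g)
  rearrange = solve-∀

^∸1≡∸1*geom : ∀ q .{{_ : NonZero q}} n → q ^ n ∸ 1 ≡ (q ∸ 1) * geom q n
^∸1≡∸1*geom (suc y) n = cong (_∸ 1) ([1+y]^n≡1+y*geom y n)

-- The binomial coefficient n(n - 1)/2, by a recursion that avoids halving.
triangle : ℕ → ℕ
triangle zero    = 0
triangle (suc n) = n + triangle n

2*triangle : ∀ n → 2 * triangle (suc n) ≡ suc n * n
2*triangle zero    = refl
2*triangle (suc n) = begin
  2 * (suc n + triangle (suc n))          ≡⟨ *-distribˡ-+ 2 (suc n) (triangle (suc n)) ⟩
  2 * suc n + 2 * triangle (suc n)        ≡⟨ cong (λ t → 2 * suc n + t) (2*triangle n) ⟩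
  2 * suc n + suc n * n                   ≡⟨ rearrange n ⟩
  suc (suc n) * suc n                     ∎
  where
  open ≡-Reasoning
  rearrange : ∀ n → 2 * (1 + n) + (1 + n) * n ≡ (2 + n) * (1 + n)
  rearrange = solve-∀

-- This is the binomial expansion of ((1 + y)ⁿ - 1)/y, with all terms from y² on collected in `s`.
geom-expansion : ∀ y n → ∃ λ s → geom (suc y) n ≡ n + y * (triangle n + y * s)
geom-expansion y zero    = 0 , sym (trans (cong (y *_) (*-zeroʳ y)) (*-zeroʳ y))
geom-expansion y (suc n) with s , eq ← geom-expansion y n =
  -- What remains of (1 + y)(n + y t + y² s) from y² on, divided by y², where t is `triangle n`.
  triangle n + s + y * s ,
  trans (cong (λ t → 1 + suc y * t) eq) (rearrange y n (triangle n) s)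
  where
  rearrange : ∀ y n t s → 1 + (1 + y) * (n + y * (t + y * s)) ≡
              1 + n + y * (n + t + y * (t + s + y * s))
  rearrange = solve-∀

∣geom⇒∣ : ∀ {p y} n → p ∣ y → p ∣ geom (suc y) n → p ∣ n
∣geom⇒∣ {p} {y} n p∣y p∣g with s , eq ← geom-expansion y n =
  ∣m+n∣m⇒∣n (subst (p ∣_) (trans eq (+-comm n _)) p∣g) (∣m⇒∣m*n _ p∣y)

-- Here the oddness of `p` enters: `p` divides p(p - 1) = 2 · `triangle p` and does not divide 2.
-- For p = 2 the conclusion fails, as `triangle 2` is 1.
∣triangle : ∀ {p} → Prime p → ¬ 2 ∣ p → p ∣ triangle p
∣triangle {zero}  pp _   = contradiction pp ¬prime[0]
∣triangle {suc n} pp 2∤p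
  with euclidsLemma 2 (triangle (suc n)) pp (subst (suc n ∣_) (sym (2*triangle n)) (m∣m*n n))
... | inj₂ p∣t = p∣t
... | inj₁ p∣2 = contradiction (∣-reflexive (sym (prime∣prime⇒≡ pp prime[2] p∣2))) 2∤p

-- Lifting the exponent for geometric sums

module _ {p : ℕ} (pp : Prime p) (2∤p : ¬ 2 ∣ p) where

  private instance
    p≢0 = prime⇒nonZero pp

  -- Both `y` and `triangle p` are multiples of `p`, so every term of the expansion after the
  -- leading `p` is divisible by p², and the sum is `p` times a number that is 1 mod `p`.
  ν-geom[p]≡1 : ∀ {y} → p ∣ y → ν p (geom (suc y) p) ≡ 1
  ν-geom[p]≡1 {y} (divides t y≡t*p)
    with s , eq ← geom-expansion y p | divides c tri≡c*p ← ∣triangle pp 2∤p = begin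
    ν p (geom (suc y) p)                                 ≡⟨ cong (ν p) eq ⟩
    ν p (p + y * (triangle p + y * s))
      ≡⟨ cong₂ (λ a b → ν p (p + a * (b + a * s))) y≡t*p tri≡c*p ⟩
    ν p (p + t * p * (c * p + t * p * s))                ≡⟨ cong (ν p) (rearrange p t c s) ⟩
    ν p (p ^ 1 * (p * (t * (c + t * s)) + 1))
      ≡⟨ ν[p^e*u]≡e pp 1 (λ p∣ → prime∤1 pp (∣m+n∣m⇒∣n p∣ (m∣m*n _))) ⟩
    1                                                    ∎
    where
    open ≡-Reasoning
    rearrange : ∀ p t c s → p + t * p * (c * p + t * p * s) ≡ p * 1 * (p * (t * (c + t * s)) + 1)
    rearrange = solve-∀

  -- The induction peels off one factor [p]ₓ of valuation 1 and replaces the base x by x ^ p. By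
  -- `[1+y]^n≡1+y*geom` the new base is again 1 plus a multiple of `p`, so `y` has to vary along the
  -- induction.
  ν-geom[p^e]≡e : ∀ {y} → p ∣ y → ∀ e → ν p (geom (suc y) (p ^ e)) ≡ e
  ν-geom[p^e]≡e {y} p∣y zero = ν-∤ pp (subst (λ t → ¬ p ∣ 1 + t) (sym (*-zeroʳ y)) (prime∤1 pp))
  ν-geom[p^e]≡e {y} p∣y (suc e) = begin
    ν p (geom (suc y) (p * p ^ e))
      ≡⟨ cong (ν p) (geom-* (suc y) p (p ^ e)) ⟩
    ν p (geom (suc y) p * geom (suc y ^ p) (p ^ e))
      ≡⟨ ν-* pp _ _ {{geom≢0 (suc y) p}} {{geom≢0 (suc y ^ p) (p ^ e) {{m^n≢0 p e}}}} ⟩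
    ν p (geom (suc y) p) + ν p (geom (suc y ^ p) (p ^ e))
      ≡⟨ cong₂ _+_ (ν-geom[p]≡1 p∣y) (cong (λ x → ν p (geom x (p ^ e))) ([1+y]^n≡1+y*geom y p)) ⟩
    1 + ν p (geom (suc (y * geom (suc y) p)) (p ^ e))
      ≡⟨ cong suc (ν-geom[p^e]≡e (∣m⇒∣m*n _ p∣y) e) ⟩
    suc e                                                        ∎
    where open ≡-Reasoning

  -- With n = u · p ^ e and `p` not dividing u, the sum is [u]ₓ times a sum of length `p ^ e` to the
  -- base x ^ u. The first factor is u mod `p`, hence prime to `p`.
  ν-geom : ∀ {y} → p ∣ y → ∀ n .{{_ : NonZero n}} → ν p (geom (suc y) n) ≡ ν p n
  ν-geom {y} p∣y n with u , n≡ , p∤u ← ν-factor pp n = begin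
    ν p (geom (suc y) n)
      ≡⟨ cong (ν p ∘ geom (suc y)) (trans n≡ (*-comm (p ^ e) u)) ⟩
    ν p (geom (suc y) (u * p ^ e))                             ≡⟨ cong (ν p) (geom-* (suc y) u (p ^ e)) ⟩
    ν p (geom (suc y) u * geom (suc y ^ u) (p ^ e))
      ≡⟨ ν-∤* pp _ {{geom≢0 (suc y ^ u) (p ^ e) {{m^n≢0 p e}}}} (p∤u ∘ ∣geom⇒∣ u p∣y) ⟩
    ν p (geom (suc y ^ u) (p ^ e))
      ≡⟨ cong (λ x → ν p (geom x (p ^ e))) ([1+y]^n≡1+y*geom y u) ⟩
    ν p (geom (suc (y * geom (suc y) u)) (p ^ e))              ≡⟨ ν-geom[p^e]≡e (∣m⇒∣m*n _ p∣y) e ⟩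
    e                                                          ∎
    where
    open ≡-Reasoning
    e = ν p n

-- Multiplicative orders

≡1⇒∣∸1 : ∀ {p} m .{{_ : NonZero m}} → + m ≡ + 1 [mod p ] → p ∣ m ∸ 1
≡1⇒∣∸1 (suc m) = ℤ.∣⇒∣ᵤ

∣∸1⇒≡1 : ∀ {p} m .{{_ : NonZero m}} → p ∣ m ∸ 1 → + m ≡ + 1 [mod p ]
∣∸1⇒≡1 (suc m) = ℤ.∣ᵤ⇒∣

∣*∸1⇒∣∸1 : ∀ {p} m n .{{_ : NonZero m}} .{{_ : NonZero n}} → p ∣ n ∸ 1 → p ∣ m * n ∸ 1 → p ∣ m ∸ 1
∣*∸1⇒∣∸1 {p} (suc a) (suc b) p∣b p∣ =
  ∣m+n∣m⇒∣n (subst (p ∣_) (rearrange a b) p∣) (∣m⇒∣m*n (suc a) p∣b)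
  where
  -- The left side is what `suc a * suc b ∸ 1` reduces to.
  rearrange : ∀ a b → b + a * (1 + b) ≡ b * (1 + a) + a
  rearrange = solve-∀

∣^∸1 : ∀ {p} m .{{_ : NonZero m}} → p ∣ m ∸ 1 → ∀ n → p ∣ m ^ n ∸ 1
∣^∸1 {p} (suc y) p∣y n = subst (λ t → p ∣ t ∸ 1) (sym ([1+y]^n≡1+y*geom y n)) (∣m⇒∣m*n _ p∣y)

%≡[+]%⇒∣ : ∀ {p} m n .{{_ : NonZero p}} → m % p ≡ (m + n) % p → p ∣ n
%≡[+]%⇒∣ {p} m n eq = ∣m+n∣m⇒∣n (divides ((m + n) / p) (+-cancelˡ-≡ (m % p) _ _ (begin
  m % p + (m / p * p + n)              ≡⟨ +-assoc (m % p) _ n ⟨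
  m % p + m / p * p + n                ≡⟨ cong (_+ n) (m≡m%n+[m/n]*n m p) ⟨
  m + n                                ≡⟨ m≡m%n+[m/n]*n (m + n) p ⟩
  (m + n) % p + (m + n) / p * p        ≡⟨ cong (_+ (m + n) / p * p) eq ⟨
  m % p + (m + n) / p * p              ∎))) (n∣m*n (m / p))
  where open ≡-Reasoning

module _ {p q : ℕ} (pp : Prime p) (p∤q : ¬ p ∣ q) where

  private
    instance
      p≢0 = prime⇒nonZero pp
      q≢0 = ∤⇒nonZero p∤q
      q^n≢0 : ∀ {n} → NonZero (q ^ n)
      q^n≢0 {n} = m^n≢0 q n
      ord≢0 : NonZero (ord p q)
      ord≢0 = >-nonZero (proj₁ (ord-spec pp p∤q))

  ∣^ord∸1 : p ∣ q ^ ord p q ∸ 1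
  ∣^ord∸1 = ≡1⇒∣∸1 (q ^ ord p q) {{q^n≢0 {ord p q}}} (proj₁ (proj₂ (ord-spec pp p∤q)))

  ord-minimal : ∀ {s} → 0 < s → p ∣ q ^ s ∸ 1 → ord p q ≤ s
  ord-minimal {s} 0<s = proj₂ (proj₂ (ord-spec pp p∤q)) 0<s ∘ ∣∸1⇒≡1 (q ^ s) {{q^n≢0 {s}}}

  -- Dividing `n` by the order r leaves a remainder a with q ^ a ≡ 1 mod `p`; since a < r,
  -- minimality of r forces a = 0.
  ord-∣ : ∀ n → p ∣ q ^ n ∸ 1 → ord p q ∣ n
  ord-∣ n p∣ = m%n≡0⇒n∣m n r (n≤0⇒n≡0 (≮⇒≥ λ 0<a → <⇒≱ (m%n<n n r) (ord-minimal 0<a p∣q^a∸1)))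
    where
    r = ord p q
    q^n≡ : q ^ n ≡ q ^ (n % r) * (q ^ r) ^ (n / r)
    q^n≡ = begin
      q ^ n                                 ≡⟨ cong (q ^_) (m≡m%n+[m/n]*n n r) ⟩
      q ^ (n % r + n / r * r)               ≡⟨ cong (λ t → q ^ (n % r + t)) (*-comm (n / r) r) ⟩
      q ^ (n % r + r * (n / r))             ≡⟨ ^-distribˡ-+-* q (n % r) _ ⟩
      q ^ (n % r) * q ^ (r * (n / r))       ≡⟨ cong (q ^ (n % r) *_) (^-*-assoc q r (n / r)) ⟨
      q ^ (n % r) * (q ^ r) ^ (n / r)       ∎
      where open ≡-Reasoning
    p∣q^a∸1 : p ∣ q ^ (n % r) ∸ 1
    p∣q^a∸1 = ∣*∸1⇒∣∸1 (q ^ (n % r)) ((q ^ r) ^ (n / r)) {{q^n≢0 {n % r}}} {{m^n≢0 (q ^ r) (n / r) {{q^n≢0 {r}}}}}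
      (∣^∸1 (q ^ r) {{q^n≢0 {r}}} ∣^ord∸1 (n / r)) (subst (λ t → p ∣ t ∸ 1) q^n≡ p∣)

  -- Pigeonhole on 0, 1, q, …, q ^ (p - 1) modulo p: adding the residue 0, which no power
  -- attains, gives a strict bound.
  ord<p : ord p q < p
  ord<p with pigeonhole (n<1+n p) residue
    where
    residue : Fin (suc p) → Fin p
    residue zero    = 0 mod p
    residue (suc i) = (q ^ toℕ i) mod p
  ... | zero , suc j , _ , eq = contradiction
    (m%n≡0⇒n∣m (q ^ toℕ j) p (trans (sym (toℕ-fromℕ< _)) (trans (cong toℕ (sym eq)) (trans (toℕ-fromℕ< _) (m*n%n≡0 0 p)))))
    (∤-^ pp p∤q (toℕ j))
  ... | suc i , suc j , s≤s i<j , eq = ≤-<-trans (ord-minimal (m<n⇒0<n∸m i<j) p∣q^d∸1) (≤-<-trans (m∸n≤m b a) (toℕ<n j))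
    where
    a = toℕ i
    b = toℕ j
    d = b ∸ a
    q^b≡ : q ^ b ≡ q ^ a + q ^ a * (q ^ d ∸ 1)
    q^b≡ = begin
      q ^ b                                ≡⟨ cong (q ^_) (m+[n∸m]≡n (<⇒≤ i<j)) ⟨
      q ^ (a + d)                          ≡⟨ ^-distribˡ-+-* q a d ⟩
      q ^ a * q ^ d                        ≡⟨ cong (q ^ a *_) (suc-pred (q ^ d) {{q^n≢0 {d}}}) ⟨
      q ^ a * suc (q ^ d ∸ 1)              ≡⟨ *-suc (q ^ a) (q ^ d ∸ 1) ⟩
      q ^ a + q ^ a * (q ^ d ∸ 1)          ∎
      where open ≡-Reasoning
    p∣q^d∸1 : p ∣ q ^ d ∸ 1
    p∣q^d∸1 with euclidsLemma (q ^ a) (q ^ d ∸ 1) pp (%≡[+]%⇒∣ (q ^ a) _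
                   (trans (sym (toℕ-fromℕ< _)) (trans (cong toℕ eq) (trans (toℕ-fromℕ< _) (cong (_% p) q^b≡)))))
    ... | inj₁ p∣q^a = contradiction p∣q^a (∤-^ pp p∤q a)
    ... | inj₂ p∣    = p∣

  ∤ord : ¬ p ∣ ord p q
  ∤ord p∣r = <⇒≱ ord<p (∣⇒≤ p∣r)

-- Divisor sums

divisors-unique : ∀ n → Unique (divisors n)
divisors-unique n = Unique.filter⁺ (_∣? n) (Unique.map⁺ suc-injective (Unique.upTo⁺ n))

∈-divisors⁻ : ∀ {n d} → d ∈ divisors n → d ∣ n
∈-divisors⁻ {n} = proj₂ ∘ ∈-filter⁻ (_∣? n) {xs = map suc (upTo n)}

∈-divisors⁺ : ∀ {n d} .{{_ : NonZero n}} → d ∣ n → d ∈ divisors n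
∈-divisors⁺ {n} {zero}  0∣n = contradiction (0∣⇒≡0 0∣n) (≢-nonZero⁻¹ n)
∈-divisors⁺ {n} {suc d} d∣n = ∈-filter⁺ (_∣? n) (∈-map⁺ suc (∈-upTo⁺ (∣⇒≤ d∣n))) d∣n

-- Without repetitions, equality as sets is equality as bags. Sums over divisors can thus be
-- compared through membership alone, whatever the order of the lists.
unique∧⇔⇒↭ : ∀ {xs ys : List ℕ} → Unique xs → Unique ys →
             (∀ {x} → x ∈ xs → x ∈ ys) → (∀ {x} → x ∈ ys → x ∈ xs) → xs ↭ ys
unique∧⇔⇒↭ xs! ys! to from = ∼bag⇒↭ (unique∧set⇒bag xs! ys! (mk⇔ to from))

-- A divisor not divisible by `q` already divides `m`; any other is `q` times a divisor of
-- `q ^ k * m`. The two kinds are disjoint because `q` does not divide `m`.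
divisors-prime^* : ∀ {q m} → Prime q → ¬ q ∣ m → ∀ k →
                   divisors (q ^ suc k * m) ↭ divisors m ++ map (q *_) (divisors (q ^ k * m))
divisors-prime^* {q} {m} pq q∤m k = unique∧⇔⇒↭ (divisors-unique (q ^ suc k * m))
  (Unique.++⁺ (divisors-unique m) (Unique.map⁺ (*-cancelˡ-≡ _ _ q) (divisors-unique (q ^ k * m))) disjoint)
  to from
  where
  instance
    _ = prime⇒nonZero pq
    _ = ∤⇒nonZero q∤m
    _ = prime^*≢0 pq k (∤⇒nonZero q∤m)
    _ = prime^*≢0 pq (suc k) (∤⇒nonZero q∤m)
  assoc = *-assoc q (q ^ k) m
  disjoint : ∀ {d} → ¬ (d ∈ divisors m × d ∈ map (q *_) (divisors (q ^ k * m)))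
  disjoint (d∈ , d∈q*) with e , _ , refl ← ∈-map⁻ (q *_) d∈q* =
    q∤m (m*n∣⇒m∣ q e (∈-divisors⁻ {m} d∈))
  to : ∀ {d} → d ∈ divisors (q ^ suc k * m) → d ∈ divisors m ++ map (q *_) (divisors (q ^ k * m))
  to {d} d∈ with q ∣? d
  ... | no q∤d = ∈-++⁺ˡ (∈-divisors⁺ (∣prime^*⇒∣ pq q∤d (suc k) (∈-divisors⁻ {q ^ suc k * m} d∈)))
  ... | yes (divides e refl) = ∈-++⁺ʳ (divisors m) (subst (_∈ map (q *_) (divisors (q ^ k * m))) (*-comm q e)
    (∈-map⁺ (q *_) (∈-divisors⁺ (*-cancelˡ-∣ q (subst₂ _∣_ (*-comm e q) assoc (∈-divisors⁻ {q ^ suc k * m} d∈))))))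
  from : ∀ {d} → d ∈ divisors m ++ map (q *_) (divisors (q ^ k * m)) → d ∈ divisors (q ^ suc k * m)
  from d∈ with ∈-++⁻ (divisors m) d∈
  ... | inj₁ d∈m = ∈-divisors⁺ (∣n⇒∣m*n (q ^ suc k) (∈-divisors⁻ {m} d∈m))
  ... | inj₂ d∈q* with e , e∈ , refl ← ∈-map⁻ (q *_) d∈q* =
    ∈-divisors⁺ (subst (q * e ∣_) (sym assoc) (*-monoʳ-∣ q (∈-divisors⁻ {q ^ k * m} e∈)))

sum-map-* : ∀ c xs → sum (map (c *_) xs) ≡ c * sum xs
sum-map-* c []       = sym (*-zeroʳ c)
sum-map-* c (x ∷ xs) = trans (cong (λ t → c * x + t) (sum-map-* c xs)) (sym (*-distribˡ-+ c x (sum xs)))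

-- Splitting the divisors gives `σ (q ^ suc k * m) ≡ σ m + q * σ (q ^ k *
-- m)`, the Horner recursion of `geom q` scaled by `σ m`.
σ-prime^* : ∀ {q m} → Prime q → ¬ q ∣ m → ∀ k → σ (q ^ k * m) ≡ geom q (suc k) * σ m
σ-prime^* {q} {m} pq q∤m zero = begin
  σ (1 * m)                  ≡⟨ cong σ (*-identityˡ m) ⟩
  σ m                        ≡⟨ *-identityˡ (σ m) ⟨
  1 * σ m                    ≡⟨ cong (λ t → (1 + t) * σ m) (*-zeroʳ q) ⟨
  (1 + q * 0) * σ m          ∎
  where open ≡-Reasoning
σ-prime^* {q} {m} pq q∤m (suc k) = begin
  σ (q ^ suc k * m)
    ≡⟨ sum-↭ (divisors-prime^* pq q∤m k) ⟩
  sum (divisors m ++ map (q *_) (divisors (q ^ k * m)))               ≡⟨ sum-++ (divisors m) _ ⟩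
  σ m + sum (map (q *_) (divisors (q ^ k * m)))
    ≡⟨ cong (λ t → σ m + t) (sum-map-* q (divisors (q ^ k * m))) ⟩
  σ m + q * σ (q ^ k * m)
    ≡⟨ cong (λ t → σ m + q * t) (σ-prime^* pq q∤m k) ⟩
  σ m + q * (geom q (suc k) * σ m)
    ≡⟨ cong (λ t → σ m + t) (*-assoc q _ (σ m)) ⟨
  geom q (suc (suc k)) * σ m                                          ∎
  where open ≡-Reasoning

σ-prime^ : ∀ {q} → Prime q → ∀ k → σ (q ^ k) ≡ geom q (suc k)
σ-prime^ {q} pq k = begin
  σ (q ^ k)                  ≡⟨ cong σ (*-identityʳ (q ^ k)) ⟨
  -- `σ 1` evaluates to `1`.
  σ (q ^ k * 1)              ≡⟨ σ-prime^* pq (prime∤1 pq) k ⟩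
  geom q (suc k) * 1         ≡⟨ *-identityʳ _ ⟩
  geom q (suc k)             ∎
  where open ≡-Reasoning

σ≢0 : ∀ n .{{_ : NonZero n}} → NonZero (σ n)
σ≢0 n = ≢-nonZero λ σn≡0 → ≢-nonZero⁻¹ n (n≤0⇒n≡0 (subst (n ≤_) σn≡0 (n≤σn (∈-divisors⁺ ∣-refl))))
  where
  n≤σn : ∀ {x xs} → x ∈ xs → x ≤ sum xs
  n≤σn {x} (here refl) = m≤m+n x _
  n≤σn (there {y} x∈)  = m≤n⇒m≤o+n y (n≤σn x∈)

-- Prime divisors

∈-primeDivisors⁻ : ∀ {n q} → q ∈ primeDivisors n → Prime q × q ∣ n
∈-primeDivisors⁻ {n} q∈ with q∈div , pq ← ∈-filter⁻ prime? {xs = divisors n} q∈ = pq , ∈-divisors⁻ {n} q∈div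

∈-primeDivisors⁺ : ∀ {n q} .{{_ : NonZero n}} → Prime q → q ∣ n → q ∈ primeDivisors n
∈-primeDivisors⁺ pq q∣n = ∈-filter⁺ prime? (∈-divisors⁺ q∣n) pq

primeDivisors-unique : ∀ n → Unique (primeDivisors n)
primeDivisors-unique n = Unique.filter⁺ prime? (divisors-unique n)

primeDivisors-prime^* : ∀ {q m} → Prime q → ¬ q ∣ m → ∀ k →
                        primeDivisors (q ^ suc k * m) ↭ q ∷ primeDivisors m
primeDivisors-prime^* {q} {m} pq q∤m k = unique∧⇔⇒↭ (primeDivisors-unique (q ^ suc k * m))
  (All.tabulate (λ { x∈ refl → q∤m (proj₂ (∈-primeDivisors⁻ {m} x∈)) }) ∷ primeDivisors-unique m)
  to from
  where
  instance
    _ = ∤⇒nonZero q∤m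
    _ = prime^*≢0 pq (suc k) (∤⇒nonZero q∤m)
  to : ∀ {x} → x ∈ primeDivisors (q ^ suc k * m) → x ∈ q ∷ primeDivisors m
  to {x} x∈ with px , x∣ ← ∈-primeDivisors⁻ {q ^ suc k * m} x∈ | q ∣? x
  ... | yes q∣x = here (sym (prime∣prime⇒≡ pq px q∣x))
  ... | no  q∤x = there (∈-primeDivisors⁺ px (∣prime^*⇒∣ pq q∤x (suc k) x∣))
  from : ∀ {x} → x ∈ q ∷ primeDivisors m → x ∈ primeDivisors (q ^ suc k * m)
  from (here refl) = ∈-primeDivisors⁺ pq (∣m⇒∣m*n m (m∣m*n (q ^ k)))
  from (there x∈) with px , x∣m ← ∈-primeDivisors⁻ {m} x∈ = ∈-primeDivisors⁺ px (∣n⇒∣m*n (q ^ suc k) x∣m)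

-- Induction over prime powers, and sorting a sum into cases

∃-primeDivisor : ∀ n .{{_ : NonZero n}} → n ≡ 1 ⊎ ∃ λ q → Prime q × q ∣ n
∃-primeDivisor n with factorise n
... | record { factors = []     ; isFactorisation = n≡1 } = inj₁ n≡1
... | record { factors = q ∷ qs ; isFactorisation = n≡  ; factorsPrime = pq ∷ _ } =
  inj₂ (q , pq , subst (q ∣_) (sym n≡) (m∣m*n _))

-- Strong induction: for n ≠ 1 the full power of some prime divisor `q` is split off, and the
-- cofactor is smaller than n and prime to `q`.
prime-power-induction : (P : Pred ℕ 0ℓ) → P 1 →
  (∀ {q m} k → Prime q → ¬ q ∣ m → P m → P (q ^ suc k * m)) →
  ∀ n .{{_ : NonZero n}} → P n
prime-power-induction P P1 step n@(suc _) = <-rec (λ n → n ≢ 0 → P n) rec n (λ ())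
  where
  rec : ∀ n → (∀ {m} → m < n → m ≢ 0 → P m) → n ≢ 0 → P n
  rec n ih n≢0 with ∃-primeDivisor n {{≢-nonZero n≢0}}
  ... | inj₁ refl = P1
  ... | inj₂ (q , pq , q∣n) with u , n≡ , q∤u ← ν-factor pq n {{≢-nonZero n≢0}} = split (ν q n) n≡
    where
    instance
      _ = prime⇒nonZero pq
      u≢0 = ∤⇒nonZero q∤u
    u<q^1+k*u : ∀ k → u < q ^ suc k * u
    u<q^1+k*u k = subst (u <_) (*-comm u _) (m<m*n u (q ^ suc k)
      (<-≤-trans (nonTrivial⇒n>1 q {{prime⇒nonTrivial pq}}) (m≤m*n q (q ^ k) {{m^n≢0 q k}})))
    split : ∀ e → n ≡ q ^ e * u → P n
    -- Exponent 0 would make n equal to the cofactor, which `q` does not divide.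
    split zero    n≡u = contradiction (subst (q ∣_) (trans n≡u (*-identityˡ u)) q∣n) q∤u
    split (suc k) n≡q^*u = subst P (sym n≡q^*u)
      (step k pq q∤u (ih (subst (u <_) (sym n≡q^*u) (u<q^1+k*u k)) (≢-nonZero⁻¹ u)))

-- Turns one sum over all prime divisors into the two filtered sums of part (b). The trichotomy is
-- asked only of the entries of the list, so that being a prime divisor may be used in establishing
-- it.
sum-filter-split : ∀ {P Q : Pred ℕ 0ℓ} (P? : Decidable P) (Q? : Decidable Q) (f g h : ℕ → ℕ) {xs} →
  All (λ x → P x × ¬ Q x × h x ≡ f x
           ⊎ ¬ P x × Q x × h x ≡ g x
           ⊎ ¬ P x × ¬ Q x × h x ≡ 0) xs →
  sum (map h xs) ≡ sum (map f (filter P? xs)) + sum (map g (filter Q? xs))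
sum-filter-split P? Q? f g h [] = refl
sum-filter-split P? Q? f g h {x ∷ xs} (cases ∷ rest) with ih ← sum-filter-split P? Q? f g h rest | cases
... | inj₁ (Px , ¬Qx , hx≡)
  rewrite filter-accept P? {xs = xs} Px | filter-reject Q? {xs = xs} ¬Qx =
  trans (cong₂ _+_ hx≡ ih) (sym (+-assoc (f x) _ _))
... | inj₂ (inj₁ (¬Px , Qx , hx≡))
  rewrite filter-reject P? {xs = xs} ¬Px | filter-accept Q? {xs = xs} Qx =
  trans (cong₂ _+_ hx≡ ih) (swap (g x) (sum (map f (filter P? xs))) _)
  where
  swap : ∀ a b c → a + (b + c) ≡ b + (a + c)
  swap = solve-∀
... | inj₂ (inj₂ (¬Px , ¬Qx , hx≡))
  rewrite filter-reject P? {xs = xs} ¬Px | filter-reject Q? {xs = xs} ¬Qx =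
  trans (cong (_+ sum (map h xs)) hx≡) ih

-- The valuation of `σ`, at prime powers and in general

module _ {p q : ℕ} (pp : Prime p) (pq : Prime q) where

  -- Every term of 1 + p + ... + p ^ k but the first is divisible by `p`.
  ν-σ-self : p ≡ q → ∀ k → ν p (σ (q ^ k)) ≡ 0
  ν-σ-self refl k = trans (cong (ν p) (σ-prime^ pq k))
    (ν-∤ pp λ p∣ → prime∤1 pp (∣m+n∣m⇒∣n (subst (p ∣_) (+-comm 1 _) p∣) (m∣m*n _)))

  ν-σ-∤ord : p ≢ q → ∀ k → ¬ ord p q ∣ k + 1 → ν p (σ (q ^ k)) ≡ 0
  ν-σ-∤ord p≢q k ord∤ = trans (cong (ν p) (σ-prime^ pq k))
    (ν-∤ pp λ p∣ → ord∤ (subst (ord p q ∣_) (+-comm 1 k)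
      (ord-∣ pp (p≢q ∘ prime∣prime⇒≡ pp pq) (suc k)
        (subst (p ∣_) (sym (^∸1≡∸1*geom q (suc k))) (∣n⇒∣m*n (q ∸ 1) p∣)))))
    where instance _ = prime⇒nonZero pq

  module _ (2∤p : ¬ 2 ∣ p) where

    ν-σ-≡1 : + q ≡ + 1 [mod p ] → ∀ k → ν p (σ (q ^ k)) ≡ ν p (k + 1)
    ν-σ-≡1 q≡1 k = begin
      ν p (σ (q ^ k))                     ≡⟨ cong (ν p) (σ-prime^ pq k) ⟩
      ν p (geom q (suc k))                ≡⟨ cong (λ x → ν p (geom x (suc k))) (suc-pred q) ⟨
      ν p (geom (suc (q ∸ 1)) (suc k))    ≡⟨ ν-geom pp 2∤p (≡1⇒∣∸1 q q≡1) (suc k) ⟩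
      ν p (suc k)                         ≡⟨ cong (ν p) (+-comm 1 k) ⟩
      ν p (k + 1)                         ∎
      where
      open ≡-Reasoning
      instance _ = prime⇒nonZero pq

    ν-σ-ord∣ : p ≢ q → ¬ + q ≡ + 1 [mod p ] → ∀ k → ord p q ∣ k + 1 →
               ν p (σ (q ^ k)) ≡ ν p (k + 1) + ν p (q ^ ord p q ∸ 1)
    ν-σ-ord∣ p≢q q≢1 k (divides s k+1≡s*r) = begin
      ν p (σ (q ^ k))                                ≡⟨ cong (ν p) (σ-prime^ pq k) ⟩
      ν p (geom q (suc k))
        ≡⟨ cong (ν p ∘ geom q) (trans (+-comm 1 k) k+1≡r*s) ⟩
      ν p (geom q (r * s))                           ≡⟨ cong (ν p) (geom-* q r s) ⟩
      ν p (geom q r * geom (q ^ r) s)                ≡⟨ ν-* pp _ _ {{geom≢0 q r}} {{geom≢0 (q ^ r) s}} ⟩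
      ν p (geom q r) + ν p (geom (q ^ r) s)          ≡⟨ cong₂ _+_ ν[q^r∸1]≡ ν[k+1]≡ ⟨
      ν p (q ^ r ∸ 1) + ν p (k + 1)                  ≡⟨ +-comm (ν p (q ^ r ∸ 1)) _ ⟩
      ν p (k + 1) + ν p (q ^ r ∸ 1)                  ∎
      where
      open ≡-Reasoning
      r = ord p q
      p∤q : ¬ p ∣ q
      p∤q = p≢q ∘ prime∣prime⇒≡ pp pq
      k+1≡r*s : k + 1 ≡ r * s
      k+1≡r*s = trans k+1≡s*r (*-comm s r)
      instance
        q≢0 = prime⇒nonZero pq
        r≢0 : NonZero r
        r≢0 = ∤⇒nonZero (∤ord pp p∤q)
        s≢0 : NonZero s
        s≢0 = m*n≢0⇒m≢0 s {{subst NonZero k+1≡s*r (subst NonZero (+-comm 1 k) _)}}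
      ν[q^r∸1]≡ : ν p (q ^ r ∸ 1) ≡ ν p (geom q r)
      -- The factor `q ∸ 1` of `q ^ r ∸ 1` is prime to `p` since `q` is not 1 mod `p`.
      ν[q^r∸1]≡ = trans (cong (ν p) (^∸1≡∸1*geom q r))
        (ν-∤* pp (geom q r) {{geom≢0 q r}} (q≢1 ∘ ∣∸1⇒≡1 q))
      ν[k+1]≡ : ν p (k + 1) ≡ ν p (geom (q ^ r) s)
      ν[k+1]≡ = begin
        ν p (k + 1)                          ≡⟨ cong (ν p) k+1≡r*s ⟩
        ν p (r * s)                          ≡⟨ ν-∤* pp s (∤ord pp p∤q) ⟩
        -- The base `q ^ r` is 1 mod `p` by the definition of the order, so `ν-geom` applies with
        -- `y = q ^ r ∸ 1`.
        ν p s                                ≡⟨ ν-geom pp 2∤p (∣^ord∸1 pp p∤q) s ⟨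
        ν p (geom (suc (q ^ r ∸ 1)) s)
          ≡⟨ cong (λ x → ν p (geom x s)) (suc-pred (q ^ r) {{m^n≢0 q r}}) ⟩
        ν p (geom (q ^ r) s)                 ∎

-- Multiplicativity of `σ` made additive by `ν p`: adjoining a power of a new prime `q` adds the
-- term of `q` and leaves the terms of the other primes as they were.
ν-σ-sum : ∀ {p} → Prime p → ∀ n .{{_ : NonZero n}} →
          ν p (σ n) ≡ sum (map (λ q → ν p (σ (q ^ ν q n))) (primeDivisors n))
ν-σ-sum {p} pp = prime-power-induction
  (λ n → ν p (σ n) ≡ sum (map (λ q → ν p (σ (q ^ ν q n))) (primeDivisors n)))
  -- `σ 1` evaluates to `1` and `primeDivisors 1` to the empty list.
  (ν-∤ pp (prime∤1 pp)) step
  where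
  step : ∀ {q m} k → Prime q → ¬ q ∣ m →
    ν p (σ m) ≡ sum (map (λ q → ν p (σ (q ^ ν q m))) (primeDivisors m)) →
    let n = q ^ suc k * m in
    ν p (σ n) ≡ sum (map (λ q → ν p (σ (q ^ ν q n))) (primeDivisors n))
  step {q} {m} k pq q∤m ih = begin
    ν p (σ n)                                            ≡⟨ cong (ν p) (σ-prime^* pq q∤m (suc k)) ⟩
    ν p (geom q (suc (suc k)) * σ m)                     ≡⟨ ν-* pp _ (σ m) {{_}} {{σ≢0 m}} ⟩
    ν p (geom q (suc (suc k))) + ν p (σ m)
      ≡⟨ cong₂ _+_ (cong (ν p) (sym (σ-prime^ pq (suc k)))) ih ⟩
    sum (ν p (σ (q ^ suc k)) ∷ map (term m) (primeDivisors m))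
      ≡⟨ cong₂ (λ e xs → sum (ν p (σ (q ^ e)) ∷ xs)) (ν[p^e*u]≡e pq (suc k) q∤m) (map-cong-local (All.tabulate term-n≡term-m)) ⟨
    sum (map (term n) (q ∷ primeDivisors m))
      ≡⟨ sum-↭ (map⁺ (term n) (primeDivisors-prime^* pq q∤m k)) ⟨
    sum (map (term n) (primeDivisors n))                 ∎
    where
    open ≡-Reasoning
    n = q ^ suc k * m
    instance _ = ∤⇒nonZero q∤m
    term : ℕ → ℕ → ℕ
    term n q = ν p (σ (q ^ ν q n))
    -- A prime divisor of `m` differs from `q`, so the factor `q ^ suc k` does not change its
    -- exponent.
    term-n≡term-m : ∀ {x} → x ∈ primeDivisors m → term n x ≡ term m x
    term-n≡term-m {x} x∈ with px , x∣m ← ∈-primeDivisors⁻ {m} x∈ =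
      cong (λ e → ν p (σ (x ^ e))) (ν-∤* px m (∤-^ px x∤q (suc k)))
      where
      x∤q : ¬ x ∣ q
      x∤q x∣q with refl ← prime∣prime⇒≡ px pq x∣q = q∤m x∣m

theorem1p2 : ∀ (p : ℕ) → Prime p → ¬ (2 ∣ p) →
  (∀ (q k : ℕ) → Prime q → 0 < k →
    let r = ord p q
        zeroCase = p ≡ q ⊎ (¬ (+ q ≡ + 1 [mod p ]) × ¬ (+ k ≡ -1ℤ [mod r ]))
    in
    (+ q ≡ + 1 [mod p ] →
      ν p (σ (q ^ k)) ≡ ν p (k + 1))
    × (zeroCase →
      ν p (σ (q ^ k)) ≡ 0)
    × (¬ (+ q ≡ + 1 [mod p ]) → ¬ zeroCase →
      ν p (σ (q ^ k)) ≡ ν p (k + 1) + ν p (q ^ r ∸ 1)))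
  ×
  (∀ (n : ℕ) → 0 < n →
    ν p (σ n) ≡
      sum (map (λ q → ν p (ν q n + 1))
        (filter (λ q → + q ≡? + 1 [mod p ]) (primeDivisors n)))
      +
      sum (map (λ q → ν p (ν q n + 1) + ν p (q ^ ord p q ∸ 1))
        (filter (λ q → ¬? (q ≟ p)
                       ×-dec ¬? (+ q ≡? + 1 [mod p ])
                       ×-dec (ord p q ∣? (ν q n + 1)))
          (primeDivisors n))))
theorem1p2 p pp 2∤p =
  (λ q k pq _ → (λ q≡1 → ν-σ-≡1 pp pq 2∤p q≡1 k) , zeroCase pq k , otherwise pq k) ,
  λ n 0<n → let instance _ = >-nonZero 0<n in
    trans (ν-σ-sum pp n) (sum-filter-split _ _ _ _ _ (All.tabulate (classify n)))
  where
  zeroCase : ∀ {q} → Prime q → ∀ k →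
    p ≡ q ⊎ (¬ (+ q ≡ + 1 [mod p ]) × ¬ (+ k ≡ -1ℤ [mod ord p q ])) → ν p (σ (q ^ k)) ≡ 0
  -- Equality of the primes is decided first, because the second alternative may also hold when `p`
  -- is `q`, where `ord p q` is not an order.
  zeroCase {q} pq k case with p ≟ q | case
  ... | yes p≡q | _                   = ν-σ-self pp pq p≡q k
  ... | no  p≢q | inj₁ p≡q            = contradiction p≡q p≢q
  -- The integer `+ k` minus `-1ℤ` computes to `+ (k + 1)`, so the congruence is divisibility of
  -- `k + 1` by the order.
  ... | no  p≢q | inj₂ (_ , k≢-1)     = ν-σ-∤ord pp pq p≢q k (k≢-1 ∘ ℤ.∣ᵤ⇒∣)

  otherwise : ∀ {q} → Prime q → ∀ k → ¬ (+ q ≡ + 1 [mod p ]) →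
    ¬ (p ≡ q ⊎ (¬ (+ q ≡ + 1 [mod p ]) × ¬ (+ k ≡ -1ℤ [mod ord p q ]))) →
    ν p (σ (q ^ k)) ≡ ν p (k + 1) + ν p (q ^ ord p q ∸ 1)
  otherwise {q} pq k q≢1 ¬zero = ν-σ-ord∣ pp pq 2∤p (¬zero ∘ inj₁) q≢1 k
    -- The hypothesis only refutes non-divisibility; decidability removes the double negation.
    (decidable-stable (ord p q ∣? (k + 1)) λ ord∤ → ¬zero (inj₂ (q≢1 , ord∤ ∘ ℤ.∣⇒∣ᵤ)))

  -- The three cases of part (a) at the exponent `ν q n`, in the form that `sum-filter-split`
  -- consumes.
  classify : ∀ n {q} → q ∈ primeDivisors n →
    let P = + q ≡ + 1 [mod p ]
        Q = ¬ (q ≡ p) × ¬ P × ord p q ∣ (ν q n + 1)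
        h = ν p (σ (q ^ ν q n))
    in P × ¬ Q × h ≡ ν p (ν q n + 1)
       ⊎ ¬ P × Q × h ≡ ν p (ν q n + 1) + ν p (q ^ ord p q ∸ 1)
       ⊎ ¬ P × ¬ Q × h ≡ 0
  classify n {q} q∈ with pq , _ ← ∈-primeDivisors⁻ {n} q∈
    | + q ≡? + 1 [mod p ] | q ≟ p | ord p q ∣? (ν q n + 1)
  ... | yes q≡1 | _       | _        = inj₁ (q≡1 , (λ (_ , q≢1 , _) → q≢1 q≡1) , ν-σ-≡1 pp pq 2∤p q≡1 (ν q n))
  ... | no  q≢1 | yes q≡p | _        =
    inj₂ (inj₂ (q≢1 , (λ (q≢p , _) → q≢p q≡p) , ν-σ-self pp pq (sym q≡p) (ν q n)))
  ... | no  q≢1 | no  q≢p | yes ord∣ =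
    inj₂ (inj₁ (q≢1 , (q≢p , q≢1 , ord∣) , ν-σ-ord∣ pp pq 2∤p (q≢p ∘ sym) q≢1 (ν q n) ord∣))
  ... | no  q≢1 | no  q≢p | no  ord∤ =
    inj₂ (inj₂ (q≢1 , (λ (_ , _ , ord∣) → ord∤ ord∣) , ν-σ-∤ord pp pq (q≢p ∘ sym) (ν q n) ord∤))
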